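{- The generating function $\mathcal{X}_P(z)=\sum_{n\ge 0}X_{P_n}z^n$ of the chromatic symmetric functions of paths satisfies $$\mathcal{X}_P(z)=\frac{K(z)}{D(z)}+e_1z\,\frac{G(z)}{D(z)}+(1+e_1z).$$
   Context: The chromatic symmetric function of a finite simple graph $H=(V,E)$ is $X_H=\sum_\kappa\prod_{u\in V}x_{\kappa(u)}$, the sum over all proper colorings $\kappa:V\to\mathbb{Z}_{>0}$. $P_n$ is the path on $n$ vertices ($X_{P_0}=1$). $e_i$ is the $i$-th elementary symmetric function. Notation: $K(z)=\sum_{i\ge 2}ie_iz^i$, $G(z)=\sum_{i\ge 2}(i-1)e_iz^i$, $D(z)=1-G(z)$. -}

module Defs where

open import Algebra.Bundles.Raw using (RawRing)
import Algebra.Definitions.RawMonoid as RawMonoidDefs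
open import Data.Bool.Base using (if_then_else_)
open import Data.Fin.Base using (Fin; zero; suc; toℕ)
import Data.Fin.Properties as Fin
open import Data.Integer.Base as ℤ using (ℤ; 0ℤ; 1ℤ)
import Data.Integer.Properties as ℤ
open import Data.List.Base using (List; []; _∷_; _++_; _∷ʳ_; map; foldr; filter; length; upTo; applyUpTo; cartesianProductWith)
open import Data.List.Properties using (map-++; map-∘; map-cong; upTo-∷ʳ)
open import Data.Nat.Base using (ℕ; zero; suc; _∸_)
import Data.Nat.Properties as ℕ
open import Data.Product.Base using (_×_; _,_)
open import Data.Sum.Base using (_⊎_; inj₁; inj₂; swap)
open import Data.Vec.Base as Vec using (Vec; []; _∷_; lookup)
open import Data.Vec.Functional using (Vector)
open import Data.Vec.Membership.Propositional using (_∈_)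
open import Data.Vec.Relation.Unary.Any using (here; there)
open import Data.Vec.Relation.Unary.Linked using (Linked; linked?)
open import Function.Base using (_∘_; id)
open import Level using (0ℓ)
open import Relation.Binary.Core using (Rel)
import Relation.Binary.Definitions as B
open import Relation.Binary.PropositionalEquality using (_≡_; _≢_; refl; sym; trans; cong; cong₂; module ≡-Reasoning)
open import Relation.Nullary.Decidable using (does; yes; no; _⊎-dec_; _→-dec_; ¬?)
open import Relation.Unary using (Pred; Decidable)

-- The list a₀ ∷ a₁ ∷ … ∷ aₖ₋₁ ∷ [] stands for x₀^a₀ x₁^a₁ ⋯ xₖ₋₁^aₖ₋₁, so
-- two lists stand for the same monomial iff they agree up to trailing zeros.
Exponents : Set
Exponents = List ℕ

-- An element of ℤ[[x₀, x₁, x₂, …]]; `stable` makes `coeff` a function of the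
-- monomial.
record Series : Set where
  field
    coeff  : Exponents → ℤ
    stable : ∀ a → coeff (a ∷ʳ 0) ≡ coeff a

open Series public

infix 4 _≈ₛ_
_≈ₛ_ : Rel Series 0ℓ
f ≈ₛ g = ∀ a → coeff f a ≡ coeff g a

∑ : {A : Set} → (A → ℤ) → List A → ℤ
∑ g as = foldr ℤ._+_ 0ℤ (map g as)

-- All ways of writing a monomial as a product of two monomials.
splits : Exponents → List (Exponents × Exponents)
splits []      = ([] , []) ∷ []
splits (n ∷ a) = cartesianProductWith (λ { i (b , c) → i ∷ b , (n ∸ i) ∷ c }) (upTo (suc n)) (splits a)

convolve : (f g : Exponents → ℤ) → Exponents → ℤ
convolve f g a = ∑ (λ { (b , c) → f b ℤ.* g c }) (splits a)

coeff-1 : Exponents → ℤ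
coeff-1 []          = 1ℤ
coeff-1 (zero  ∷ a) = coeff-1 a
coeff-1 (suc _ ∷ a) = 0ℤ

coeff-x : ℕ → Exponents → ℤ
coeff-x c       []                = 0ℤ
coeff-x zero    (zero ∷ a)        = 0ℤ
coeff-x zero    (suc zero ∷ a)    = coeff-1 a
coeff-x zero    (suc (suc _) ∷ a) = 0ℤ
coeff-x (suc c) (zero ∷ a)        = coeff-x c a
coeff-x (suc c) (suc _ ∷ a)       = 0ℤ

∑-cong : {A : Set} {g h : A → ℤ} → (∀ x → g x ≡ h x) → ∀ as → ∑ g as ≡ ∑ h as
∑-cong eq as = cong (foldr ℤ._+_ 0ℤ) (map-cong eq as)

∑-map : {A B : Set} (g : B → ℤ) (f : A → B) → ∀ as → ∑ g (map f as) ≡ ∑ (g ∘ f) as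
∑-map g f as = cong (foldr ℤ._+_ 0ℤ) (sym (map-∘ as))

∑-++ : {A : Set} (g : A → ℤ) → ∀ as bs → ∑ g (as ++ bs) ≡ ∑ g as ℤ.+ ∑ g bs
∑-++ g []       bs = sym (ℤ.+-identityˡ _)
∑-++ g (a ∷ as) bs = trans (cong (λ t → g a ℤ.+ t) (∑-++ g as bs)) (sym (ℤ.+-assoc (g a) _ _))

∑-0 : {A : Set} {g : A → ℤ} → (∀ x → g x ≡ 0ℤ) → ∀ as → ∑ g as ≡ 0ℤ
∑-0 eq []       = refl
∑-0 eq (a ∷ as) = cong₂ ℤ._+_ (eq a) (∑-0 eq as)

∑-× : {A B C : Set} (g : C → ℤ) (f : A → B → C) → ∀ as bs →
      ∑ g (cartesianProductWith f as bs) ≡ ∑ (λ a → ∑ (λ b → g (f a b)) bs) as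
∑-× g f []       bs = refl
∑-× g f (a ∷ as) bs = trans (∑-++ g (map (f a) bs) _) (cong₂ ℤ._+_ (∑-map g (f a) bs) (∑-× g f as bs))

pad : Exponents × Exponents → Exponents × Exponents
pad (b , c) = b ∷ʳ 0 , c ∷ʳ 0

splits-∷ʳ : ∀ a → splits (a ∷ʳ 0) ≡ map pad (splits a)
splits-∷ʳ []      = refl
splits-∷ʳ (n ∷ a) = trans (cong (cartesianProductWith step (upTo (suc n))) (splits-∷ʳ a)) (go (upTo (suc n)))
  where
  step : ℕ → Exponents × Exponents → Exponents × Exponents
  step = λ { i (b , c) → i ∷ b , (n ∸ i) ∷ c }
  go : ∀ is → cartesianProductWith step is (map pad (splits a)) ≡ map pad (cartesianProductWith step is (splits a))
  go []       = refl
  go (i ∷ is) = sym (trans (map-++ pad (map (step i) (splits a)) _)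
                      (cong₂ _++_ (trans (sym (map-∘ (splits a))) (map-∘ (splits a))) (sym (go is))))

convolve-∷ʳ : ∀ f g a → convolve f g (a ∷ʳ 0) ≡ convolve (f ∘ (_∷ʳ 0)) (g ∘ (_∷ʳ 0)) a
convolve-∷ʳ f g a = trans (cong (∑ _) (splits-∷ʳ a)) (∑-map _ pad (splits a))

coeff-1-∷ʳ : ∀ a → coeff-1 (a ∷ʳ 0) ≡ coeff-1 a
coeff-1-∷ʳ []          = refl
coeff-1-∷ʳ (zero  ∷ a) = coeff-1-∷ʳ a
coeff-1-∷ʳ (suc _ ∷ a) = refl

coeff-x-∷ʳ : ∀ c a → coeff-x c (a ∷ʳ 0) ≡ coeff-x c a
coeff-x-∷ʳ zero    []                = refl
coeff-x-∷ʳ (suc c) []                = refl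
coeff-x-∷ʳ zero    (zero ∷ a)        = refl
coeff-x-∷ʳ zero    (suc zero ∷ a)    = coeff-1-∷ʳ a
coeff-x-∷ʳ zero    (suc (suc _) ∷ a) = refl
coeff-x-∷ʳ (suc c) (zero ∷ a)        = coeff-x-∷ʳ c a
coeff-x-∷ʳ (suc c) (suc _ ∷ a)       = refl

infixl 6 _+ₛ_
infixl 7 _*ₛ_

_+ₛ_ _*ₛ_ : Series → Series → Series

coeff  (f +ₛ g) a = coeff f a ℤ.+ coeff g a
stable (f +ₛ g) a = cong₂ ℤ._+_ (stable f a) (stable g a)

coeff  (f *ₛ g) = convolve (coeff f) (coeff g)
stable (f *ₛ g) a = trans (convolve-∷ʳ (coeff f) (coeff g) a)
  (∑-cong (λ { (b , c) → cong₂ ℤ._*_ (stable f b) (stable g c) }) (splits a))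

-ₛ_ : Series → Series
coeff  (-ₛ f) a = ℤ.- coeff f a
stable (-ₛ f) a = cong ℤ.-_ (stable f a)

0ₛ 1ₛ : Series

coeff  0ₛ _ = 0ℤ
stable 0ₛ _ = refl

coeff  1ₛ = coeff-1
stable 1ₛ = coeff-1-∷ʳ

x : ℕ → Series
coeff  (x c) = coeff-x c
stable (x c) = coeff-x-∷ʳ c

seriesRawRing : RawRing 0ℓ 0ℓ
seriesRawRing = record
  { Carrier = Series ; _≈_ = _≈ₛ_ ; _+_ = _+ₛ_ ; _*_ = _*ₛ_ ; -_ = -ₛ_ ; 0# = 0ₛ ; 1# = 1ₛ }

words : ∀ n → List ℕ → List (Vec ℕ n)
words zero    cs = [] ∷ []
words (suc n) cs = cartesianProductWith _∷_ cs (words n cs)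

∏x : ∀ {n} → Vec ℕ n → Series
∏x []      = 1ₛ
∏x (c ∷ w) = x c *ₛ ∏x w

∑∏x< : ℕ → ∀ {n} {P : Pred (Vec ℕ n) 0ℓ} → Decidable P → Series
∑∏x< k {n} P? = foldr _+ₛ_ 0ₛ (map ∏x (filter P? (words n (upTo k))))

-- The coefficients involving only x₀, …, xₖ₋₁ of a multiple of xₖ vanish.
coeff-x-length : ∀ a → coeff-x (length a) (a ∷ʳ 0) ≡ 0ℤ
coeff-x-length []          = refl
coeff-x-length (zero  ∷ a) = coeff-x-length a
coeff-x-length (suc _ ∷ a) = refl

∑-splits-0 : ∀ (h : Exponents × Exponents → ℤ) a →
             (∀ b c → length b ≡ length a → length c ≡ length a → h (b , c) ≡ 0ℤ) → ∑ h (splits a) ≡ 0ℤ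
∑-splits-0 h []      eq = trans (ℤ.+-identityʳ _) (eq [] [] refl refl)
∑-splits-0 h (n ∷ a) eq = trans (∑-× h _ (upTo (suc n)) (splits a))
  (∑-0 (λ i → ∑-splits-0 _ a (λ b c p q → eq (i ∷ b) ((n ∸ i) ∷ c) (cong suc p) (cong suc q))) (upTo (suc n)))

∏x-∈ : ∀ {n k} {w : Vec ℕ n} → k ∈ w → ∀ a → length a ≡ k → coeff (∏x w) (a ∷ʳ 0) ≡ 0ℤ
∏x-∈ {w = k ∷ w} (here refl) a refl =
  trans (convolve-∷ʳ (coeff (x k)) (coeff (∏x w)) a)
        (∑-splits-0 _ a λ b c p _ → trans (cong (ℤ._* coeff (∏x w) (c ∷ʳ 0)) (vanish b p)) (ℤ.*-zeroˡ (coeff (∏x w) (c ∷ʳ 0))))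
  where
  vanish : ∀ b → length b ≡ k → coeff-x k (b ∷ʳ 0) ≡ 0ℤ
  vanish b p = trans (cong (λ l → coeff-x l (b ∷ʳ 0)) (sym p)) (coeff-x-length b)
∏x-∈ {w = c₀ ∷ w} (there k∈w) a refl =
  trans (convolve-∷ʳ (coeff (x c₀)) (coeff (∏x w)) a)
        (∑-splits-0 _ a λ b c _ q → trans (cong (coeff (x c₀) (b ∷ʳ 0) ℤ.*_) (∏x-∈ k∈w c q)) (ℤ.*-zeroʳ (coeff (x c₀) (b ∷ʳ 0))))

∑-words-∷ʳ : ∀ n cs k (g : Vec ℕ n → ℤ) → (∀ w → k ∈ w → g w ≡ 0ℤ) →
             ∑ g (words n (cs ∷ʳ k)) ≡ ∑ g (words n cs)
∑-words-∷ʳ zero    cs k g g0 = refl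
∑-words-∷ʳ (suc n) cs k g g0 = begin
  ∑ g (words (suc n) (cs ∷ʳ k))                                 ≡⟨ ∑-× g _∷_ (cs ∷ʳ k) _ ⟩
  ∑ (λ c → ∑ (g ∘ (c ∷_)) (words n (cs ∷ʳ k))) (cs ∷ʳ k)
    ≡⟨ ∑-cong (λ c → ∑-words-∷ʳ n cs k (g ∘ (c ∷_)) (λ w k∈w → g0 (c ∷ w) (there k∈w))) (cs ∷ʳ k) ⟩
  ∑ h (cs ∷ʳ k)                                                 ≡⟨ ∑-++ h cs (k ∷ []) ⟩
  ∑ h cs ℤ.+ (h k ℤ.+ 0ℤ)
    ≡⟨ cong (λ t → ∑ h cs ℤ.+ (t ℤ.+ 0ℤ)) (∑-0 (λ w → g0 (k ∷ w) (here refl)) (words n cs)) ⟩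
  ∑ h cs ℤ.+ 0ℤ                                                 ≡⟨ ℤ.+-identityʳ _ ⟩
  ∑ h cs                                                        ≡⟨ sym (∑-× g _∷_ cs _) ⟩
  ∑ g (words (suc n) cs)                                        ∎
  where
  open ≡-Reasoning
  h : ℕ → ℤ
  h c = ∑ (g ∘ (c ∷_)) (words n cs)

module _ {n} {P : Pred (Vec ℕ n) 0ℓ} (P? : Decidable P) where

  weight : Exponents → Vec ℕ n → ℤ
  weight a w = if does (P? w) then coeff (∏x w) a else 0ℤ

  coeff-∑ : ∀ ws a → coeff (foldr _+ₛ_ 0ₛ (map ∏x (filter P? ws))) a ≡ ∑ (weight a) ws
  coeff-∑ []       a = refl
  coeff-∑ (w ∷ ws) a with P? w
  ... | yes _ = cong (λ t → coeff (∏x w) a ℤ.+ t) (coeff-∑ ws a)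
  ... | no  _ = trans (coeff-∑ ws a) (sym (ℤ.+-identityˡ _))

  weight-∷ʳ : ∀ a w → weight (a ∷ʳ 0) w ≡ weight a w
  weight-∷ʳ a w with P? w
  ... | yes _ = stable (∏x w) a
  ... | no  _ = refl

  weight-∈ : ∀ a w → length a ∈ w → weight (a ∷ʳ 0) w ≡ 0ℤ
  weight-∈ a w k∈w with P? w
  ... | yes _ = ∏x-∈ k∈w a refl
  ... | no  _ = refl

  length-∷ʳ : ∀ (a : Exponents) → length (a ∷ʳ 0) ≡ suc (length a)
  length-∷ʳ []      = refl
  length-∷ʳ (_ ∷ a) = cong suc (length-∷ʳ a)

  ∑∏x-stable : ∀ a → coeff (∑∏x< (length (a ∷ʳ 0)) P?) (a ∷ʳ 0) ≡ coeff (∑∏x< (length a) P?) a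
  ∑∏x-stable a = begin
    coeff (∑∏x< (length (a ∷ʳ 0)) P?) (a ∷ʳ 0)           ≡⟨ coeff-∑ (words n (upTo (length (a ∷ʳ 0)))) (a ∷ʳ 0) ⟩
    ∑ (weight (a ∷ʳ 0)) (words n (upTo (length (a ∷ʳ 0))))
      ≡⟨ cong (∑ (weight (a ∷ʳ 0)) ∘ words n) (trans (cong upTo (length-∷ʳ a)) (sym (upTo-∷ʳ (length a)))) ⟩
    ∑ (weight (a ∷ʳ 0)) (words n (upTo (length a) ∷ʳ length a))
      ≡⟨ ∑-words-∷ʳ n (upTo (length a)) (length a) _ (weight-∈ a) ⟩
    ∑ (weight (a ∷ʳ 0)) (words n (upTo (length a)))      ≡⟨ ∑-cong (weight-∷ʳ a) (words n (upTo (length a))) ⟩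
    ∑ (weight a) (words n (upTo (length a)))             ≡⟨ sym (coeff-∑ (words n (upTo (length a))) a) ⟩
    coeff (∑∏x< (length a) P?) a                         ∎
    where open ≡-Reasoning

-- The sum of x_{w₁} ⋯ x_{wₙ} over all w : Vec ℕ n satisfying P.  A word with
-- a letter ≥ length a contributes nothing to the coefficient at a, which is
-- therefore that of the finite sum over words with letters < length a.
∑∏x : ∀ {n} {P : Pred (Vec ℕ n) 0ℓ} → Decidable P → Series
coeff  (∑∏x P?) a = coeff (∑∏x< (length a) P?) a
stable (∑∏x P?)   = ∑∏x-stable P?

-- eₙ = ∑_{j₁ < ⋯ < jₙ} x_{j₁} ⋯ x_{jₙ}
e : ℕ → Series
e n = ∑∏x {n} (linked? ℕ._<?_)

record SimpleGraph (n : ℕ) : Set₁ where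
  field
    Adj    : Rel (Fin n) 0ℓ
    adj?   : B.Decidable Adj
    symm   : B.Symmetric Adj
    irrefl : B.Irreflexive _≡_ Adj

open SimpleGraph public

-- The colours are 0, 1, 2, … in place of 1, 2, 3, …
Proper : ∀ {n} → SimpleGraph n → Vec ℕ n → Set
Proper H κ = ∀ u v → Adj H u v → lookup κ u ≢ lookup κ v

proper? : ∀ {n} (H : SimpleGraph n) → Decidable (Proper H)
proper? H κ = Fin.all? λ u → Fin.all? λ v → adj? H u v →-dec ¬? (lookup κ u ℕ.≟ lookup κ v)

chromatic : ∀ {n} → SimpleGraph n → Series
chromatic H = ∑∏x (proper? H)

path : ∀ n → SimpleGraph n
Adj    (path n) u v = toℕ v ≡ suc (toℕ u) ⊎ toℕ u ≡ suc (toℕ v)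
adj?   (path n) u v = (toℕ v ℕ.≟ suc (toℕ u)) ⊎-dec (toℕ u ℕ.≟ suc (toℕ v))
symm   (path n)     = swap
irrefl (path n) refl (inj₁ p) = ℕ.1+n≢n (sym p)
irrefl (path n) refl (inj₂ p) = ℕ.1+n≢n (sym p)

-- In the formal power series f, f n is the coefficient of zⁿ.
module PowerSeries {c ℓ} (R : RawRing c ℓ) where
  private module R = RawRing R
  open RawMonoidDefs R.+-rawMonoid using (sum)

  powerSeriesRawRing : RawRing c ℓ
  powerSeriesRawRing = record
    { Carrier = ℕ → R.Carrier
    ; _≈_     = λ f g → ∀ n → f n R.≈ g n
    ; _+_     = λ f g n → f n R.+ g n
    ; _*_     = λ f g n → sum {suc n} λ i → f (toℕ i) R.* g (n ∸ toℕ i)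
    ; -_      = λ f n → R.- f n
    ; 0#      = λ _ → R.0#
    ; 1#      = λ { zero → R.1# ; (suc _) → R.0# }
    }

  linear : R.Carrier → ℕ → R.Carrier
  linear r 1 = r
  linear r _ = R.0#

  -- The quotient f / d for d with constant term 1, by the recursion
  -- qₙ = fₙ - (d₁ qₙ₋₁ + ⋯ + dₙ q₀).
  module Quotient (f d : ℕ → R.Carrier) where

    next : ∀ n → Vector R.Carrier n → R.Carrier
    next n qs = f n R.+ (R.- sum λ i → d (suc (toℕ i)) R.* qs i)

    -- qₙ₋₁, …, q₀
    previous : ∀ n → Vector R.Carrier n
    previous (suc n) zero    = next n (previous n)
    previous (suc n) (suc i) = previous n i

  infixl 7 _/_
  _/_ : (f d : ℕ → R.Carrier) → ℕ → R.Carrier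
  (f / d) n = next n (previous n)
    where open Quotient f d

open PowerSeries seriesRawRing public
open RawRing powerSeriesRawRing public using (_≈_; _+_; _*_; -_; 1#)
open RawMonoidDefs (RawRing.+-rawMonoid seriesRawRing) using (sum) renaming (_×_ to _·_)

K G D : ℕ → Series

K zero                = 0ₛ
K (suc zero)          = 0ₛ
K i@(suc (suc _))     = i · e i

G zero                = 0ₛ
G (suc zero)          = 0ₛ
G i@(suc i-1@(suc _)) = i-1 · e i

D = 1# + (- G)

e₁z : ℕ → Series
e₁z = linear (e 1)

𝒳ₚ : ℕ → Series
𝒳ₚ n = chromatic (path n)

D-constant : D 0 ≈ₛ 1ₛ
D-constant a = ℤ.+-identityʳ (coeff-1 a)

convolve-1ˡ : ∀ (f : Exponents → ℤ) a → convolve coeff-1 f a ≡ f a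
convolve-1ˡ f []      = trans (ℤ.+-identityʳ _) (ℤ.*-identityˡ (f []))
convolve-1ˡ f (n ∷ a) = begin
  convolve coeff-1 f (n ∷ a)                     ≡⟨ ∑-× _ _ (upTo (suc n)) (splits a) ⟩
  convolve coeff-1 (f ∘ (n ∷_)) a ℤ.+ ∑ rest (applyUpTo suc n)
    ≡⟨ cong₂ ℤ._+_ (convolve-1ˡ (f ∘ (n ∷_)) a) (rest-0 id n) ⟩
  f (n ∷ a) ℤ.+ 0ℤ                               ≡⟨ ℤ.+-identityʳ _ ⟩
  f (n ∷ a)                                      ∎
  where
  open ≡-Reasoning
  rest : ℕ → ℤ
  rest i = ∑ (λ { (b , c) → coeff-1 (i ∷ b) ℤ.* f ((n ∸ i) ∷ c) }) (splits a)
  rest-0 : ∀ (h : ℕ → ℕ) m → ∑ rest (applyUpTo (suc ∘ h) m) ≡ 0ℤ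
  rest-0 h zero    = refl
  rest-0 h (suc m) = cong₂ ℤ._+_ (∑-0 (λ { (b , c) → ℤ.*-zeroˡ (f ((n ∸ suc (h 0)) ∷ c)) }) (splits a)) (rest-0 (h ∘ suc) m)

sum-cong : ∀ {n} {f g : Vector Series n} → (∀ i → f i ≡ g i) → sum f ≡ sum g
sum-cong {zero}  eq = refl
sum-cong {suc n} eq = cong₂ _+ₛ_ (eq zero) (sum-cong (eq ∘ suc))

*-/-cancel : ∀ f d → d 0 ≈ₛ 1ₛ → d * (f / d) ≈ f
*-/-cancel f d d₀≈1 n a = begin
  coeff (d 0 *ₛ q n) a ℤ.+ coeff (sum {n} λ i → d (suc (toℕ i)) *ₛ q (n ∸ suc (toℕ i))) a
    ≡⟨ cong₂ ℤ._+_ leading (cong (λ s → coeff s a) (sum-cong {n} (λ i → cong (d (suc (toℕ i)) *ₛ_) (sym (previous-q n i))))) ⟩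
  coeff (f n) a ℤ.- t ℤ.+ t                ≡⟨ ℤ.+-assoc (coeff (f n) a) (ℤ.- t) t ⟩
  coeff (f n) a ℤ.+ (ℤ.- t ℤ.+ t)          ≡⟨ cong (λ s → coeff (f n) a ℤ.+ s) (ℤ.+-inverseˡ t) ⟩
  coeff (f n) a ℤ.+ 0ℤ                     ≡⟨ ℤ.+-identityʳ _ ⟩
  coeff (f n) a                            ∎
  where
  open ≡-Reasoning
  open Quotient f d
  q : ℕ → Series
  q = f / d
  t : ℤ
  t = coeff (sum {n} λ i → d (suc (toℕ i)) *ₛ previous n i) a
  previous-q : ∀ n i → previous n i ≡ q (n ∸ suc (toℕ i))
  previous-q (suc n) zero    = refl
  previous-q (suc n) (suc i) = previous-q n i
  leading : coeff (d 0 *ₛ q n) a ≡ coeff (q n) a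
  leading = trans (∑-cong (λ { (b , c) → cong (ℤ._* coeff (q n) c) (d₀≈1 b) }) (splits a)) (convolve-1ˡ (coeff (q n)) a)

{-# OPTIONS --safe #-}
module Submission where

open import Algebra.Bundles using (CommutativeRing)
open import Algebra.Bundles.Raw using (RawRing)
import Algebra.Definitions.RawMonoid as RawMonoidDefs
import Algebra.Morphism.RingMonomorphism as RingMonomorphism
open import Algebra.Morphism.Structures using (IsRingMonomorphism)
import Algebra.Properties.CommutativeMonoid.Sum as FiniteSum
import Algebra.Properties.CommutativeMonoid.Mult as CommutativeMonoidMult
import Algebra.Properties.CommutativeSemigroup as CommutativeSemigroupProperties
import Algebra.Properties.Ring as RingProperties
import Algebra.Properties.Semiring.Mult as SemiringMult
import Algebra.Properties.Semiring.Sum as SemiringSum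
import Algebra.Solver.Ring.NaturalCoefficients.Default as SemiringSolver
open import Algebra.Structures using (IsCommutativeRing)
open import Data.Fin.Base using (zero; suc; toℕ)
import Data.Integer.Base as ℤ
import Data.Integer.Properties as ℤ
open import Data.List.Base using (List; []; _∷_; _++_; _∷ʳ_; foldr; map; filter; length; upTo; applyUpTo; cartesianProductWith)
open import Data.List.Properties using (filter-++; filter-accept; filter-all; filter-none; filter-reject; filter-≐; map-cong; ++-assoc)
open import Data.List.Membership.Propositional using (_∈_)
open import Data.List.Membership.Propositional.Properties using (∈-insert)
open import Data.List.Relation.Unary.All as All using (All; []; _∷_)
open import Data.List.Relation.Unary.AllPairs as AllPairs using (AllPairs; []; _∷_)
open import Data.List.Relation.Unary.AllPairs.Properties using (applyUpTo⁺₁)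
open import Data.List.Relation.Unary.Any using (here; there)
open import Data.List.Relation.Unary.Unique.Propositional using (Unique)
open import Data.Nat.Base as ℕ using (ℕ; zero; suc; _∸_)
import Data.Nat.Properties as ℕ
open import Data.Product.Base using (_,_)
open import Data.Sum.Base as Sum using (inj₁; inj₂)
open import Data.Vec.Base using (Vec; []; _∷_; lookup)
open import Data.Vec.Functional using (Vector)
open import Data.Vec.Relation.Unary.Linked as Linked using (Linked; []; [-]; _∷_; linked?)
open import Defs using (module PowerSeries; words)
open import Function.Base using (_∘_; case_of_; flip; id)
open import Level using (0ℓ)
open import Relation.Binary.Core using (Rel)
open import Relation.Binary.Definitions using (Decidable)
open import Relation.Binary.PropositionalEquality as ≡ using (_≡_; _≢_)
open import Relation.Nullary.Decidable using (yes; no; ¬?)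
open import Relation.Nullary.Negation using (¬_)
import Relation.Binary.Reasoning.Setoid as ≈-Reasoning
import Relation.Unary as Unary

-- Fix the number k of colours and let A c be the generating function in z of the
-- words w such that c ∷ w properly colours a path.  Classifying words by their
-- first letter gives 𝒳 = 1 + ∑ y c A c and 𝒳 = (1 + y c) A c, where y c = x c z.
-- Multiplying the former by E = ∏ (1 + y c) = ∑ eₙ zⁿ yields E 𝒳 = E + z E′ 𝒳, hence
-- D 𝒳 = E because D = E - z E′, and K + e₁ z G + D (1 + e₁ z) = E as well.
-- Equality on monomials in k variables makes Series a commutative ring, being that
-- of k-fold iterated power series over ℤ.

-- The commutative ring of formal power series over a commutative ring.

module PowerSeriesRing {c ℓ} (R : CommutativeRing c ℓ) where
  open CommutativeRing R
  open FiniteSum +-commutativeMonoid using (sum; sum-cong-≋; ∑-distrib-+; sum-replicate-zero)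
  open SemiringSum semiring using (*-distribˡ-sum; *-distribʳ-sum)
  open CommutativeSemigroupProperties +-commutativeSemigroup using (x∙yz≈y∙xz)
  open ≈-Reasoning setoid
  private module S = PowerSeries rawRing
  open RawRing S.powerSeriesRawRing public using ()
    renaming (_≈_ to infix 4 _≋_; _+_ to infixl 6 _⊕_; _*_ to infixl 7 _⊛_; -_ to ⊝_; 0# to 𝟘; 1# to 𝟙)

  -- The Cauchy product is by definition such a sum, of the terms `f i * g j`, so the laws of `_⊛_`
  -- reduce to rearrangements of sums over i + j = n.
  antidiagonal : ℕ → (ℕ → ℕ → Carrier) → Carrier
  antidiagonal n f = sum {suc n} λ i → f (toℕ i) (n ∸ toℕ i)

  antidiagonal-cong : ∀ n {f g : ℕ → ℕ → Carrier} → (∀ i j → f i j ≈ g i j) → antidiagonal n f ≈ antidiagonal n g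
  antidiagonal-cong n f≈g = sum-cong-≋ {suc n} λ i → f≈g (toℕ i) (n ∸ toℕ i)

  antidiagonal-+ : ∀ n f g → antidiagonal n (λ i j → f i j + g i j) ≈ antidiagonal n f + antidiagonal n g
  antidiagonal-+ n f g = ∑-distrib-+ {suc n} (λ i → f (toℕ i) (n ∸ toℕ i)) (λ i → g (toℕ i) (n ∸ toℕ i))

  *-distribˡ-antidiagonal : ∀ r n f → r * antidiagonal n f ≈ antidiagonal n (λ i j → r * f i j)
  *-distribˡ-antidiagonal r n f = *-distribˡ-sum {suc n} r (λ i → f (toℕ i) (n ∸ toℕ i))

  *-distribʳ-antidiagonal : ∀ r n f → antidiagonal n f * r ≈ antidiagonal n (λ i j → f i j * r)
  *-distribʳ-antidiagonal r n f = *-distribʳ-sum {suc n} r (λ i → f (toℕ i) (n ∸ toℕ i))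

  -- The sum unfolds only at its first index, i = 0. Reaching the other end takes an induction,
  -- which commutativity by flipping relies on.
  antidiagonal-last : ∀ n f → antidiagonal (suc n) f ≈ f (suc n) 0 + antidiagonal n (λ i j → f i (suc j))
  antidiagonal-last zero    f = x∙yz≈y∙xz _ _ _
  antidiagonal-last (suc n) f = begin
    f 0 (suc (suc n)) + antidiagonal (suc n) (f ∘ suc)
      ≈⟨ +-congˡ (antidiagonal-last n (f ∘ suc)) ⟩
    f 0 (suc (suc n)) + (f (suc (suc n)) 0 + antidiagonal n (λ i j → f (suc i) (suc j)))
      ≈⟨ x∙yz≈y∙xz _ _ _ ⟩
    f (suc (suc n)) 0 + antidiagonal (suc n) (λ i j → f i (suc j)) ∎

  antidiagonal-flip : ∀ n f → antidiagonal n f ≈ antidiagonal n (flip f)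
  antidiagonal-flip zero    f = refl
  antidiagonal-flip (suc n) f = begin
    f 0 (suc n) + antidiagonal n (f ∘ suc)                    ≈⟨ +-congˡ (antidiagonal-flip n (f ∘ suc)) ⟩
    f 0 (suc n) + antidiagonal n (λ i j → f (suc j) i)        ≈⟨ antidiagonal-last n (flip f) ⟨
    antidiagonal (suc n) (flip f)                             ∎

  -- Both sides run over all i + j + k = n. Splitting off the terms with i = 0 leaves the same claim
  -- for `f ∘ suc` in degree one lower.
  antidiagonal-assoc : ∀ n (f : ℕ → ℕ → ℕ → Carrier) →
    antidiagonal n (λ m k → antidiagonal m λ i j → f i j k) ≈ antidiagonal n (λ i m → antidiagonal m (f i))
  antidiagonal-assoc zero    f = refl
  antidiagonal-assoc (suc n) f = begin
    (f 0 0 (suc n) + 0#) + antidiagonal n (λ m k → f 0 (suc m) k + antidiagonal m λ i j → f (suc i) j k)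
      ≈⟨ +-cong (+-identityʳ _) (antidiagonal-+ n (f 0 ∘ suc) (λ m k → antidiagonal m λ i j → f (suc i) j k)) ⟩
    f 0 0 (suc n) + (antidiagonal n (f 0 ∘ suc) + antidiagonal n (λ m k → antidiagonal m λ i j → f (suc i) j k))
      ≈⟨ +-assoc _ _ _ ⟨
    antidiagonal (suc n) (f 0) + antidiagonal n (λ m k → antidiagonal m λ i j → f (suc i) j k)
      ≈⟨ +-congˡ (antidiagonal-assoc n (f ∘ suc)) ⟩
    antidiagonal (suc n) (f 0) + antidiagonal n (λ i m → antidiagonal m (f (suc i))) ∎

  ⊛-cong : ∀ {f f′ g g′} → f ≋ f′ → g ≋ g′ → f ⊛ g ≋ f′ ⊛ g′
  ⊛-cong f≋f′ g≋g′ n = antidiagonal-cong n λ i j → *-cong (f≋f′ i) (g≋g′ j)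

  ⊛-comm : ∀ f g → f ⊛ g ≋ g ⊛ f
  ⊛-comm f g n = trans (antidiagonal-flip n λ i j → f i * g j) (antidiagonal-cong n λ i j → *-comm (f j) (g i))

  ⊛-assoc : ∀ f g h → (f ⊛ g) ⊛ h ≋ f ⊛ (g ⊛ h)
  ⊛-assoc f g h n = begin
    antidiagonal n (λ m k → antidiagonal m (λ i j → f i * g j) * h k)
      ≈⟨ antidiagonal-cong n (λ m k → trans (*-distribʳ-antidiagonal (h k) m λ i j → f i * g j)
                                       (antidiagonal-cong m λ i j → *-assoc (f i) (g j) (h k))) ⟩
    antidiagonal n (λ m k → antidiagonal m (λ i j → f i * (g j * h k)))
      ≈⟨ antidiagonal-assoc n (λ i j k → f i * (g j * h k)) ⟩
    antidiagonal n (λ i m → antidiagonal m (λ j k → f i * (g j * h k)))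
      ≈⟨ antidiagonal-cong n (λ i m → *-distribˡ-antidiagonal (f i) m λ j k → g j * h k) ⟨
    antidiagonal n (λ i m → f i * antidiagonal m (λ j k → g j * h k)) ∎

  ⊛-identityˡ : ∀ f → 𝟙 ⊛ f ≋ f
  ⊛-identityˡ f n = begin
    1# * f n + sum {n} (λ i → 0# * f (n ∸ suc (toℕ i)))
      ≈⟨ +-cong (*-identityˡ (f n)) (trans (sum-cong-≋ {n} λ i → zeroˡ _) (sum-replicate-zero n)) ⟩
    f n + 0#  ≈⟨ +-identityʳ (f n) ⟩
    f n       ∎

  ⊛-distribʳ-⊕ : ∀ h f g → (f ⊕ g) ⊛ h ≋ (f ⊛ h) ⊕ (g ⊛ h)
  ⊛-distribʳ-⊕ h f g n = trans (antidiagonal-cong n λ i j → distribʳ (h j) (f i) (g i))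
                               (antidiagonal-+ n (λ i j → f i * h j) (λ i j → g i * h j))

  ⊛-identityʳ : ∀ f → f ⊛ 𝟙 ≋ f
  ⊛-identityʳ f n = trans (⊛-comm f 𝟙 n) (⊛-identityˡ f n)

  ⊛-distribˡ-⊕ : ∀ h f g → h ⊛ (f ⊕ g) ≋ (h ⊛ f) ⊕ (h ⊛ g)
  ⊛-distribˡ-⊕ h f g n =
    trans (⊛-comm h (f ⊕ g) n) (trans (⊛-distribʳ-⊕ h f g n) (+-cong (⊛-comm f h n) (⊛-comm g h n)))

  isCommutativeRing-powerSeries : IsCommutativeRing _≋_ _⊕_ _⊛_ ⊝_ 𝟘 𝟙
  isCommutativeRing-powerSeries = record
    { isRing = record
      { +-isAbelianGroup = record
        { isGroup = record
          { isMonoid = record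
            { isSemigroup = record
              { isMagma = record
                { isEquivalence = record
                  { refl  = λ _ → refl
                  ; sym   = λ f≋g n → sym (f≋g n)
                  ; trans = λ f≋g g≋h n → trans (f≋g n) (g≋h n)
                  }
                ; ∙-cong = λ f≋f′ g≋g′ n → +-cong (f≋f′ n) (g≋g′ n)
                }
              ; assoc = λ f g h n → +-assoc (f n) (g n) (h n)
              }
            ; identity = (λ f n → +-identityˡ (f n)) , (λ f n → +-identityʳ (f n))
            }
          ; inverse = (λ f n → -‿inverseˡ (f n)) , (λ f n → -‿inverseʳ (f n))
          ; ⁻¹-cong = λ f≋g n → -‿cong (f≋g n)
          }
        ; comm = λ f g n → +-comm (f n) (g n)
        }
      ; *-cong     = ⊛-cong
      ; *-assoc    = ⊛-assoc
      ; *-identity = ⊛-identityˡ , ⊛-identityʳ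
      ; distrib    = ⊛-distribˡ-⊕ , ⊛-distribʳ-⊕
      }
    ; *-comm = ⊛-comm
    }

  powerSeriesRing : CommutativeRing c ℓ
  powerSeriesRing = record { isCommutativeRing = isCommutativeRing-powerSeries }

  open S public using (linear)

  linear-⊛-zero : ∀ r f → (linear r ⊛ f) 0 ≈ 0#
  linear-⊛-zero r f = trans (+-identityʳ _) (zeroˡ (f 0))

  linear-⊛-suc : ∀ r f n → (linear r ⊛ f) (suc n) ≈ r * f n
  linear-⊛-suc r f n = begin
    0# * f (suc n) + (r * f n + sum {n} λ i → 0# * f (n ∸ suc (toℕ i)))
      ≈⟨ +-cong (zeroˡ _) (+-congˡ (trans (sum-cong-≋ {n} λ i → zeroˡ _) (sum-replicate-zero n))) ⟩
    0# + (r * f n + 0#)  ≈⟨ trans (+-identityˡ _) (+-identityʳ _) ⟩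
    r * f n              ∎

-- Finite sums over lists.

module ListSum {c ℓ} (R : CommutativeRing c ℓ) where
  open CommutativeRing R
  open CommutativeSemigroupProperties +-commutativeSemigroup using (x∙yz≈y∙xz)

  ∑ : {A : Set} → (A → Carrier) → List A → Carrier
  ∑ f as = foldr _+_ 0# (map f as)

  ∑-cong : {A : Set} {f g : A → Carrier} → (∀ a → f a ≈ g a) → ∀ as → ∑ f as ≈ ∑ g as
  ∑-cong f≈g []       = refl
  ∑-cong f≈g (a ∷ as) = +-cong (f≈g a) (∑-cong f≈g as)

  ∑-++ : {A : Set} (f : A → Carrier) → ∀ as bs → ∑ f (as ++ bs) ≈ ∑ f as + ∑ f bs
  ∑-++ f []       bs = sym (+-identityˡ _)
  ∑-++ f (a ∷ as) bs = trans (+-congˡ (∑-++ f as bs)) (sym (+-assoc _ _ _))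

  -- Without repetitions in `cs`, the filter drops exactly one entry. This compares all colours with
  -- those allowed next to `c`.
  ∑-remove : ∀ (f : ℕ → Carrier) {c cs} → c ∈ cs → Unique cs →
             ∑ f cs ≈ f c + ∑ f (filter (λ d → ¬? (c ℕ.≟ d)) cs)
  ∑-remove f {c} {cs = c ∷ cs} (here ≡.refl) (c∉cs ∷ _) = +-congˡ (reflexive (≡.cong (∑ f) (≡.sym
    (≡.trans (filter-reject (λ d → ¬? (c ℕ.≟ d)) (λ c≢c → c≢c ≡.refl)) (filter-all (λ d → ¬? (c ℕ.≟ d)) c∉cs)))))
  ∑-remove f {c} {cs = d ∷ cs} (there c∈cs) (d∉cs ∷ u) = begin
    f d + ∑ f cs                                         ≈⟨ +-congˡ (∑-remove f c∈cs u) ⟩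
    f d + (f c + ∑ f (filter (λ d → ¬? (c ℕ.≟ d)) cs))   ≈⟨ x∙yz≈y∙xz _ _ _ ⟩
    f c + ∑ f (d ∷ filter (λ d → ¬? (c ℕ.≟ d)) cs)
      ≡⟨ ≡.cong (λ ds → f c + ∑ f ds) (filter-accept (λ d → ¬? (c ℕ.≟ d)) (All.lookup d∉cs c∈cs ∘ ≡.sym)) ⟨
    f c + ∑ f (filter (λ d → ¬? (c ℕ.≟ d)) (d ∷ cs))     ∎
    where open ≈-Reasoning setoid

-- Logarithmic derivative of the product of the factors 1 + y c.

module ProductRule {c ℓ} (R : CommutativeRing c ℓ) (y : ℕ → CommutativeRing.Carrier R) where
  open CommutativeRing R
  open ListSum R
  open SemiringSolver commutativeSemiring
  open ≈-Reasoning setoid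

  ∏[1+y] : List ℕ → Carrier
  ∏[1+y] []       = 1#
  ∏[1+y] (c ∷ cs) = (1# + y c) * ∏[1+y] cs

  -- The image of ∏[1+y] under a derivation fixing every y c.
  ∂∏[1+y] : List ℕ → Carrier
  ∂∏[1+y] []       = 0#
  ∂∏[1+y] (c ∷ cs) = y c * ∏[1+y] cs + (1# + y c) * ∂∏[1+y] cs

  -- Formally `Y c` is X / (1 + y c), so multiplying `y c * Y c` by the product replaces its factor
  -- 1 + y c by y c. Summed over c, this is the product rule. The induction needs no division.
  ∏*∑≈∂∏*X : ∀ (Y : ℕ → Carrier) X cs → (∀ {c} → c ∈ cs → (1# + y c) * Y c ≈ X) →
             ∏[1+y] cs * ∑ (λ c → y c * Y c) cs ≈ ∂∏[1+y] cs * X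
  ∏*∑≈∂∏*X Y X []       Y≈ = trans (zeroʳ 1#) (sym (zeroˡ X))
  ∏*∑≈∂∏*X Y X (c ∷ cs) Y≈ = begin
    (1# + y c) * P * (y c * Y c + S)
      ≈⟨ solve 4 (λ p y Y S → (con 1 :+ y) :* p :* (y :* Y :+ S) := y :* p :* ((con 1 :+ y) :* Y) :+ (con 1 :+ y) :* (p :* S))
           refl P (y c) (Y c) S ⟩
    y c * P * ((1# + y c) * Y c) + (1# + y c) * (P * S)
      ≈⟨ +-cong (*-congˡ (Y≈ (here ≡.refl))) (*-congˡ (∏*∑≈∂∏*X Y X cs (Y≈ ∘ there))) ⟩
    y c * P * X + (1# + y c) * (∂∏[1+y] cs * X)
      ≈⟨ trans (+-congˡ (sym (*-assoc _ _ _))) (sym (distribʳ _ _ _)) ⟩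
    (y c * P + (1# + y c) * ∂∏[1+y] cs) * X  ∎
    where
    P = ∏[1+y] cs
    S = ∑ (λ c → y c * Y c) cs

-- Generating functions of words over a finite alphabet.

module WordSum {r ℓ} (R : CommutativeRing r ℓ) (x : ℕ → CommutativeRing.Carrier R) (cs : List ℕ) where
  open CommutativeRing R
  open ListSum R

  ∏ : ∀ {n} → Vec ℕ n → Carrier
  ∏ []      = 1#
  ∏ (c ∷ w) = x c * ∏ w

  wordSum : ∀ {n} {P : Unary.Pred (Vec ℕ n) 0ℓ} → Unary.Decidable P → Carrier
  wordSum {n} P? = ∑ ∏ (filter P? (words n cs))

  module _ {n} {P : Unary.Pred (Vec ℕ (suc n)) 0ℓ} (P? : Unary.Decidable P) where

    ∑-filter-map : ∀ c ws → ∑ ∏ (filter P? (map (c ∷_) ws)) ≈ x c * ∑ ∏ (filter (P? ∘ (c ∷_)) ws)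
    ∑-filter-map c []       = sym (zeroʳ (x c))
    ∑-filter-map c (w ∷ ws) with P? (c ∷ w)
    ... | yes _ = trans (+-congˡ (∑-filter-map c ws)) (sym (distribˡ _ _ _))
    ... | no  _ = ∑-filter-map c ws

    ∑-filter-× : ∀ ds ws → ∑ ∏ (filter P? (cartesianProductWith _∷_ ds ws)) ≈
                           ∑ (λ d → x d * ∑ ∏ (filter (P? ∘ (d ∷_)) ws)) ds
    ∑-filter-× []       ws = refl
    ∑-filter-× (d ∷ ds) ws = begin
      ∑ ∏ (filter P? (map (d ∷_) ws ++ cartesianProductWith _∷_ ds ws))
        ≡⟨ ≡.cong (∑ ∏) (filter-++ P? (map (d ∷_) ws) _) ⟩
      ∑ ∏ (filter P? (map (d ∷_) ws) ++ filter P? (cartesianProductWith _∷_ ds ws))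
        ≈⟨ ∑-++ ∏ (filter P? (map (d ∷_) ws)) _ ⟩
      ∑ ∏ (filter P? (map (d ∷_) ws)) + ∑ ∏ (filter P? (cartesianProductWith _∷_ ds ws))
        ≈⟨ +-cong (∑-filter-map d ws) (∑-filter-× ds ws) ⟩
      ∑ (λ d → x d * ∑ ∏ (filter (P? ∘ (d ∷_)) ws)) (d ∷ ds)  ∎
      where open ≈-Reasoning setoid

    wordSum-suc : wordSum P? ≈ ∑ (λ c → x c * wordSum (P? ∘ (c ∷_))) cs
    wordSum-suc = ∑-filter-× cs (words n cs)

  open PowerSeriesRing R
  private
    module S  = CommutativeRing powerSeriesRing
    module SΣ = ListSum powerSeriesRing

  y : ℕ → ℕ → Carrier
  y c = linear (x c)

  ∑-zero : ∀ (f : ℕ → ℕ → Carrier) ds → SΣ.∑ (λ d → y d ⊛ f d) ds 0 ≈ 0#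
  ∑-zero f []       = refl
  ∑-zero f (d ∷ ds) = trans (+-cong (linear-⊛-zero (x d) (f d)) (∑-zero f ds)) (+-identityˡ 0#)

  ∑-suc : ∀ (f : ℕ → ℕ → Carrier) ds n → SΣ.∑ (λ d → y d ⊛ f d) ds (suc n) ≈ ∑ (λ d → x d * f d n) ds
  ∑-suc f []       n = refl
  ∑-suc f (d ∷ ds) n = +-cong (linear-⊛-suc (x d) (f d) n) (∑-suc f ds n)

  -- Words whose consecutive letters are related, classified by first letter.

  module LinkedWords {_~_ : Rel ℕ 0ℓ} (_~?_ : Decidable _~_) where

    linkedSum : ℕ → Carrier
    linkedSum n = wordSum {n} (linked? _~?_)

    -- The letter `c` only constrains the word: it counts neither in the product of variables nor in
    -- the length.
    linkedSumAfter : ℕ → ℕ → Carrier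
    linkedSumAfter c n = wordSum {n} λ w → linked? _~?_ (c ∷ w)

    wordSum-linked : ∀ {c d} n → c ~ d → wordSum {n} (λ w → linked? _~?_ (c ∷ d ∷ w)) ≈ linkedSumAfter d n
    wordSum-linked n c~d = reflexive (≡.cong (∑ ∏) (filter-≐ _ _ (Linked.tail , (c~d ∷_)) (words n cs)))

    wordSum-unlinked : ∀ {c d} n → ¬ c ~ d → wordSum {n} (λ w → linked? _~?_ (c ∷ d ∷ w)) ≈ 0#
    wordSum-unlinked n c≁d =
      reflexive (≡.cong (∑ ∏) (filter-none _ (All.universal (λ _ → c≁d ∘ Linked.head) (words n cs))))

    linkedSumAfter-suc : ∀ c n → linkedSumAfter c (suc n) ≈ ∑ (λ d → x d * linkedSumAfter d n) (filter (c ~?_) cs)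
    linkedSumAfter-suc c n = trans (wordSum-suc (λ w → linked? _~?_ (c ∷ w))) (select cs)
      where
      open ≈-Reasoning setoid
      select : ∀ ds → ∑ (λ d → x d * wordSum {n} (λ w → linked? _~?_ (c ∷ d ∷ w))) ds ≈
                      ∑ (λ d → x d * linkedSumAfter d n) (filter (c ~?_) ds)
      select []       = refl
      select (d ∷ ds) = case c ~? d of λ where
        (yes c~d) → begin
          x d * _ + _
            ≈⟨ +-cong (*-congˡ (wordSum-linked n c~d)) (select ds) ⟩
          ∑ (λ d → x d * linkedSumAfter d n) (d ∷ filter (c ~?_) ds)
            ≡⟨ ≡.cong (∑ _) (filter-accept (c ~?_) c~d) ⟨
          ∑ (λ d → x d * linkedSumAfter d n) (filter (c ~?_) (d ∷ ds))  ∎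
        (no c≁d) → begin
          x d * _ + _
            ≈⟨ +-cong (trans (*-congˡ (wordSum-unlinked n c≁d)) (zeroʳ _)) (select ds) ⟩
          0# + ∑ (λ d → x d * linkedSumAfter d n) (filter (c ~?_) ds)
            ≈⟨ +-identityˡ _ ⟩
          ∑ (λ d → x d * linkedSumAfter d n) (filter (c ~?_) ds)
            ≡⟨ ≡.cong (∑ _) (filter-reject (c ~?_) c≁d) ⟨
          ∑ (λ d → x d * linkedSumAfter d n) (filter (c ~?_) (d ∷ ds))  ∎

    -- The generating function of the linked words that are empty or start in ds.
    startingIn : List ℕ → ℕ → Carrier
    startingIn ds = 𝟙 ⊕ SΣ.∑ (λ d → y d ⊛ linkedSumAfter d) ds

    linkedSum≋startingIn : linkedSum ≋ startingIn cs
    linkedSum≋startingIn zero    = +-congˡ (sym (∑-zero linkedSumAfter cs))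
    linkedSum≋startingIn (suc n) =
      trans (wordSum-suc (linked? _~?_)) (sym (trans (+-identityˡ _) (∑-suc linkedSumAfter cs n)))

    linkedSumAfter≋startingIn : ∀ c → linkedSumAfter c ≋ startingIn (filter (c ~?_) cs)
    linkedSumAfter≋startingIn c zero    = +-congˡ (sym (∑-zero linkedSumAfter (filter (c ~?_) cs)))
    linkedSumAfter≋startingIn c (suc n) =
      trans (linkedSumAfter-suc c n) (sym (trans (+-identityˡ _) (∑-suc linkedSumAfter (filter (c ~?_) cs) n)))

  -- The functional equation relating increasing words and proper colourings.

  open ProductRule powerSeriesRing y

  -- Strictly increasing words yield the elementary symmetric functions. Words with distinct
  -- neighbours, in `X`, yield the colourings of paths.
  module E = LinkedWords ℕ._<?_
  module X = LinkedWords (λ c d → ¬? (c ℕ.≟ d))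

  [1+y]⊛ : ∀ c f → (𝟙 ⊕ y c) ⊛ f ≋ f ⊕ (y c ⊛ f)
  [1+y]⊛ c f = S.trans (S.distribʳ f 𝟙 (y c)) (S.+-congʳ (S.*-identityˡ f))

  -- A word allowed after `c` is empty or starts with another letter. The summand
  -- `y c ⊛ X.linkedSumAfter c` supplies the missing words, those starting with `c`.
  [1+y]⊛linkedSumAfter : Unique cs → ∀ {c} → c ∈ cs → (𝟙 ⊕ y c) ⊛ X.linkedSumAfter c ≋ X.linkedSum
  [1+y]⊛linkedSumAfter unique {c} c∈cs = begin
    (𝟙 ⊕ y c) ⊛ X.linkedSumAfter c                          ≈⟨ [1+y]⊛ c (X.linkedSumAfter c) ⟩
    X.linkedSumAfter c ⊕ term c                             ≈⟨ S.+-congʳ (X.linkedSumAfter≋startingIn c) ⟩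
    (𝟙 ⊕ SΣ.∑ term (filter (λ d → ¬? (c ℕ.≟ d)) cs)) ⊕ term c
      ≈⟨ solve 3 (λ o u v → (o :+ v) :+ u := o :+ (u :+ v)) S.refl 𝟙 (term c) _ ⟩
    𝟙 ⊕ (term c ⊕ SΣ.∑ term (filter (λ d → ¬? (c ℕ.≟ d)) cs))
      ≈⟨ S.+-congˡ (SΣ.∑-remove term c∈cs unique) ⟨
    X.startingIn cs                                         ≈⟨ X.linkedSum≋startingIn ⟨
    X.linkedSum                                             ∎
    where
    open ≈-Reasoning S.setoid
    open SemiringSolver S.commutativeSemiring
    term : ℕ → ℕ → Carrier
    term d = y d ⊛ X.linkedSumAfter d

  -- This identifies the letters that may follow `c` in an increasing word with a suffix of the
  -- alphabet.
  filter-> : ∀ bs c ds → AllPairs ℕ._<_ (bs ++ c ∷ ds) → filter (c ℕ.<?_) (bs ++ c ∷ ds) ≡ ds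
  filter-> []       c ds (c<ds ∷ _)  = ≡.trans (filter-reject (c ℕ.<?_) (ℕ.<-irrefl ≡.refl)) (filter-all (c ℕ.<?_) c<ds)
  filter-> (b ∷ bs) c ds (b<_ ∷ inc) =
    ≡.trans (filter-reject (c ℕ.<?_) (ℕ.<-asym (All.lookup b<_ (∈-insert bs)))) (filter-> bs c ds inc)

  -- An increasing word over a suffix `d ∷ ds` either omits `d`, or is `d` followed by an increasing
  -- word over `ds`; hence the factor 1 + y d. The prefix `bs` is carried along because
  -- `E.linkedSumAfter` ranges over all of `cs`.
  startingIn≋∏ : AllPairs ℕ._<_ cs → ∀ bs ds → bs ++ ds ≡ cs → E.startingIn ds ≋ ∏[1+y] ds
  startingIn≋∏ inc bs []       eq = S.+-identityʳ 𝟙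
  startingIn≋∏ inc bs (d ∷ ds) eq = begin
    𝟙 ⊕ (y d ⊛ E.linkedSumAfter d ⊕ rest)
      ≈⟨ solve 3 (λ o u v → o :+ (u :+ v) := (o :+ v) :+ u) S.refl 𝟙 (y d ⊛ E.linkedSumAfter d) rest ⟩
    E.startingIn ds ⊕ y d ⊛ E.linkedSumAfter d  ≈⟨ S.+-congˡ {x = E.startingIn ds} (S.*-congˡ {x = y d} after) ⟩
    E.startingIn ds ⊕ y d ⊛ E.startingIn ds     ≈⟨ [1+y]⊛ d (E.startingIn ds) ⟨
    (𝟙 ⊕ y d) ⊛ E.startingIn ds
      ≈⟨ S.*-congˡ {x = 𝟙 ⊕ y d} (startingIn≋∏ inc (bs ∷ʳ d) ds (≡.trans (++-assoc bs (d ∷ []) ds) eq)) ⟩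
    (𝟙 ⊕ y d) ⊛ ∏[1+y] ds                       ∎
    where
    open ≈-Reasoning S.setoid
    open SemiringSolver S.commutativeSemiring
    rest : ℕ → Carrier
    rest = SΣ.∑ (λ d → y d ⊛ E.linkedSumAfter d) ds
    after : E.linkedSumAfter d ≋ E.startingIn ds
    after = S.trans (E.linkedSumAfter≋startingIn d) (S.reflexive (≡.cong E.startingIn
      (≡.trans (≡.cong (filter (d ℕ.<?_)) (≡.sym eq)) (filter-> bs d ds (≡.subst (AllPairs ℕ._<_) (≡.sym eq) inc)))))

  open SemiringMult semiring using (_×_; ×-comm-*; ×-congʳ)
  open CommutativeMonoidMult +-commutativeMonoid using (×-distrib-+)

  -- The derivation z d/dz fixes the series y c = x c z.
  ∂∏≋z∙d/dz : ∀ ds n → ∂∏[1+y] ds n ≈ n × ∏[1+y] ds n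
  ∂∏≋z∙d/dz []       zero    = refl
  ∂∏≋z∙d/dz []       (suc n) = sym (trans (×-congʳ (suc n) (sym (zeroˡ 0#))) (trans (sym (×-comm-* (suc n) 0# 0#)) (zeroˡ _)))
  ∂∏≋z∙d/dz (d ∷ ds) zero    = trans
    (+-cong (linear-⊛-zero (x d) (∏[1+y] ds)) (trans ([1+y]⊛ d (∂∏[1+y] ds) 0) (+-cong (∂∏≋z∙d/dz ds 0) (linear-⊛-zero (x d) (∂∏[1+y] ds)))))
    (trans (+-identityˡ _) (+-identityˡ _))
  ∂∏≋z∙d/dz (d ∷ ds) (suc n) = begin
    (y d ⊛ P) (suc n) + ((𝟙 ⊕ y d) ⊛ T) (suc n)
      ≈⟨ +-cong (linear-⊛-suc (x d) P n) (trans ([1+y]⊛ d T (suc n)) (+-cong (∂∏≋z∙d/dz ds (suc n)) (linear-⊛-suc (x d) T n))) ⟩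
    x d * P n + (suc n × P (suc n) + x d * T n)
      ≈⟨ +-congˡ (+-congˡ (trans (*-congˡ (∂∏≋z∙d/dz ds n)) (×-comm-* n (x d) (P n)))) ⟩
    x d * P n + (suc n × P (suc n) + n × (x d * P n))
      -- The term from differentiating `y d` joins the multiple `n ×` and makes it `suc n ×`.
      ≈⟨ x∙yz≈y∙xz _ _ _ ⟩
    suc n × P (suc n) + suc n × (x d * P n)
      ≈⟨ ×-distrib-+ _ _ (suc n) ⟨
    suc n × (P (suc n) + x d * P n)
      ≈⟨ ×-congʳ (suc n) (trans ([1+y]⊛ d P (suc n)) (+-congˡ (linear-⊛-suc (x d) P n))) ⟨
    suc n × ((𝟙 ⊕ y d) ⊛ P) (suc n) ∎
    where
    open ≈-Reasoning setoid
    open CommutativeSemigroupProperties +-commutativeSemigroup using (x∙yz≈y∙xz)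
    P = ∏[1+y] ds
    T = ∂∏[1+y] ds

  -- Only the second factor is expanded by first letter. The first, as a product, then clears the
  -- denominators 1 + y c, and the sum collapses to its derivative times the unexpanded second
  -- factor. The order on `cs` gives both the product formula and the absence of repeated colours.
  E⊛X≋E⊕zE′⊛X : AllPairs ℕ._<_ cs → E.linkedSum ⊛ X.linkedSum ≋ E.linkedSum ⊕ ((λ n → n × E.linkedSum n) ⊛ X.linkedSum)
  E⊛X≋E⊕zE′⊛X inc = begin
    E.linkedSum ⊛ X.linkedSum                               ≈⟨ S.*-congˡ {x = E.linkedSum} X.linkedSum≋startingIn ⟩
    E.linkedSum ⊛ (𝟙 ⊕ rest)                                ≈⟨ S.distribˡ E.linkedSum 𝟙 rest ⟩
    E.linkedSum ⊛ 𝟙 ⊕ E.linkedSum ⊛ rest                    ≈⟨ S.+-cong (S.*-identityʳ E.linkedSum) (S.*-congʳ {x = rest} E≋∏) ⟩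
    E.linkedSum ⊕ ∏[1+y] cs ⊛ rest
      ≈⟨ S.+-congˡ {x = E.linkedSum} (∏*∑≈∂∏*X X.linkedSumAfter X.linkedSum cs ([1+y]⊛linkedSumAfter (AllPairs.map ℕ.<⇒≢ inc))) ⟩
    E.linkedSum ⊕ ∂∏[1+y] cs ⊛ X.linkedSum
      ≈⟨ S.+-congˡ {x = E.linkedSum} (S.*-congʳ {x = X.linkedSum} λ n → trans (∂∏≋z∙d/dz cs n) (×-congʳ n (sym (E≋∏ n)))) ⟩
    E.linkedSum ⊕ (λ n → n × E.linkedSum n) ⊛ X.linkedSum   ∎
    where
    open ≈-Reasoning S.setoid
    rest : ℕ → Carrier
    rest = SΣ.∑ (λ d → y d ⊛ X.linkedSumAfter d) cs
    E≋∏ : E.linkedSum ≋ ∏[1+y] cs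
    E≋∏ = S.trans E.linkedSum≋startingIn (startingIn≋∏ inc [] cs ≡.refl)

-- Solving the functional equation by cancelling D.

module Quotients {c ℓ} (R : CommutativeRing c ℓ) where
  open CommutativeRing R
  open RingProperties ring using (+-cancelʳ)
  open SemiringSolver commutativeSemiring
  open ≈-Reasoning setoid

  *-cancelˡ-invertible : ∀ {d d⁻¹ f g} → d * d⁻¹ ≈ 1# → d * f ≈ d * g → f ≈ g
  *-cancelˡ-invertible {d} {d⁻¹} {f} {g} dd⁻¹≈1 df≈dg = begin
    f               ≈⟨ *-identityˡ f ⟨
    1# * f          ≈⟨ *-congʳ dd⁻¹≈1 ⟨
    d * d⁻¹ * f     ≈⟨ solve 3 (λ d i f → d :* i :* f := i :* (d :* f)) refl d d⁻¹ f ⟩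
    d⁻¹ * (d * f)   ≈⟨ *-congˡ df≈dg ⟩
    d⁻¹ * (d * g)   ≈⟨ solve 3 (λ d i f → d :* i :* f := i :* (d :* f)) refl d d⁻¹ g ⟨
    d * d⁻¹ * g     ≈⟨ *-congʳ dd⁻¹≈1 ⟩
    1# * g          ≈⟨ *-identityˡ g ⟩
    g               ∎

  -- The roles: U = K/D, V = G/D, W = 1/D, and T = zE′ = E - D.
  X≈U+yV+u+y : ∀ {D E T X G K U V W y u} → u ≈ 1# → D + T ≈ E → E * X ≈ E + T * X → D + G ≈ u →
               D * U ≈ K → D * V ≈ G → D * W ≈ u → K + (u + y) ≈ E + G →
               X ≈ U + y * V + (u + y)
  X≈U+yV+u+y {D} {E} {T} {X} {G} {K} {U} {V} {W} {y} {u} u≈1 D+T≈E EX≈E+TX D+G≈u DU≈K DV≈G DW≈u K+u+y≈E+G =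
    *-cancelˡ-invertible (trans DW≈u u≈1) (trans DX≈E (sym D[U+yV+u+y]≈E))
    where
    DX≈E : D * X ≈ E
    DX≈E = +-cancelʳ (T * X) (D * X) E (begin
      D * X + T * X   ≈⟨ distribʳ X D T ⟨
      (D + T) * X     ≈⟨ *-congʳ D+T≈E ⟩
      E * X           ≈⟨ EX≈E+TX ⟩
      E + T * X       ∎)

    D[U+yV+u+y]≈E : D * (U + y * V + (u + y)) ≈ E
    -- Adding `G` to both sides lets `D + G ≈ u` stand in for D = 1 - G, so that the semiring
    -- solver, which knows no subtraction, applies.
    D[U+yV+u+y]≈E = +-cancelʳ G (D * (U + y * V + (u + y))) E (begin
      D * (U + y * V + (u + y)) + G
        ≈⟨ +-congʳ (*-congˡ (+-congˡ (+-congʳ u≈1))) ⟩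
      D * (U + y * V + (1# + y)) + G
        ≈⟨ solve 5 (λ D U V y G → D :* (U :+ y :* V :+ (con 1 :+ y)) :+ G := D :* U :+ y :* (D :* V) :+ D :* y :+ (D :+ G))
             refl D U V y G ⟩
      D * U + y * (D * V) + D * y + (D + G)
        ≈⟨ +-congʳ (+-congʳ (+-cong DU≈K (*-congˡ DV≈G))) ⟩
      K + y * G + D * y + (D + G)
        ≈⟨ solve 4 (λ K y G D → K :+ y :* G :+ D :* y :+ (D :+ G) := K :+ ((D :+ G) :+ y :* (D :+ G))) refl K y G D ⟩
      K + ((D + G) + y * (D + G))
        ≈⟨ +-congˡ (+-cong D+G≈u (trans (*-congˡ (trans D+G≈u u≈1)) (*-identityʳ y))) ⟩
      K + (u + y)     ≈⟨ K+u+y≈E+G ⟩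
      E + G           ∎)

-- Series restricted to k variables as iterated power series.

open import Defs

-- The coefficient of the n-th power of x₀, with the remaining variables renumbered from 0.
slice : ℕ → Series → Series
coeff  (slice n f) a = coeff f (n ∷ a)
stable (slice n f) a = stable f (n ∷ a)

-- Equality of the coefficients of all monomials in x₀, …, xₖ₋₁.
infix 4 _≈[_]_
_≈[_]_ : Series → ℕ → Series → Set
f ≈[ zero  ] g = coeff f [] ≡ coeff g []
f ≈[ suc k ] g = ∀ n → slice n f ≈[ k ] slice n g

agree⇒≈[] : ∀ k {f g} → (∀ a → length a ≡ k → coeff f a ≡ coeff g a) → f ≈[ k ] g
agree⇒≈[] zero    eq   = eq [] ≡.refl
agree⇒≈[] (suc k) eq n = agree⇒≈[] k λ a l → eq (n ∷ a) (≡.cong suc l)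

≈[]⇒agree : ∀ {f g} a → f ≈[ length a ] g → coeff f a ≡ coeff g a
≈[]⇒agree []      eq = eq
≈[]⇒agree (n ∷ a) eq = ≈[]⇒agree a (eq n)

≈ₛ⇒≈[] : ∀ k {f g} → f ≈ₛ g → f ≈[ k ] g
≈ₛ⇒≈[] k eq = agree⇒≈[] k λ a _ → eq a

truncatedRawRing : ℕ → RawRing 0ℓ 0ℓ
truncatedRawRing k = record
  { Carrier = Series ; _≈_ = _≈[ k ]_ ; _+_ = _+ₛ_ ; _*_ = _*ₛ_ ; -_ = -ₛ_ ; 0# = 0ₛ ; 1# = 1ₛ }

open RawMonoidDefs (RawRing.+-rawMonoid seriesRawRing) using (sum) renaming (_×_ to _·_)

-- This passes from the list sums in `convolve` to the `Fin`-indexed sums of power series. A general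
-- `g` is kept because `applyUpTo` recurses through `g ∘ suc`.
∑-applyUpTo : ∀ (h : ℕ → ℤ.ℤ) a n (g : ℕ → ℕ) (F : Vector Series n) →
              (∀ i → h (g (toℕ i)) ≡ coeff (F i) a) → ∑ h (applyUpTo g n) ≡ coeff (sum F) a
∑-applyUpTo h a zero    g F eq = ≡.refl
∑-applyUpTo h a (suc n) g F eq = ≡.cong₂ ℤ._+_ (eq zero) (∑-applyUpTo h a n (g ∘ suc) (F ∘ suc) (eq ∘ suc))

-- Splitting a monomial first splits its exponent of x₀, so the product is a Cauchy product in x₀.
slice-* : ∀ n f g → slice n (f *ₛ g) ≈ₛ sum {suc n} λ i → slice (toℕ i) f *ₛ slice (n ∸ toℕ i) g
slice-* n f g a = ≡.trans (∑-× _ _ (upTo (suc n)) (splits a))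
  (∑-applyUpTo (λ i → coeff (slice i f *ₛ slice (n ∸ i) g) a) a (suc n) id (λ i → slice (toℕ i) f *ₛ slice (n ∸ toℕ i) g) λ _ → ≡.refl)

-- The laws are pulled back along a monomorphism: the constant term into ℤ, or the slices into power
-- series over the ring with one variable fewer. Since `_≈[_]_` recurses on slices, preserving and
-- reflecting equality are both `id`.
truncated-isCommutativeRing : ∀ k → IsCommutativeRing _≈[ k ]_ _+ₛ_ _*ₛ_ -ₛ_ 0ₛ 1ₛ
truncated-isCommutativeRing zero = RingMonomorphism.isCommutativeRing constantTerm ℤ.+-*-isCommutativeRing
  where
  constantTerm : IsRingMonomorphism (truncatedRawRing 0) ℤ.+-*-rawRing λ f → coeff f []
  constantTerm = record
    { isRingHomomorphism = record
      { isSemiringHomomorphism = record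
        { isNearSemiringHomomorphism = record
          { +-isMonoidHomomorphism = record
            { isMagmaHomomorphism = record { isRelHomomorphism = record { cong = id } ; homo = λ _ _ → ≡.refl }
            ; ε-homo = ≡.refl
            }
          ; *-homo = λ f g → ℤ.+-identityʳ (coeff f [] ℤ.* coeff g [])
          }
        ; 1#-homo = ≡.refl
        }
      ; -‿homo = λ _ → ≡.refl
      }
    ; injective = id
    }
truncated-isCommutativeRing (suc k) = RingMonomorphism.isCommutativeRing slices isCommutativeRing-powerSeries
  where
  fewerVariables : CommutativeRing 0ℓ 0ℓ
  fewerVariables = record { isCommutativeRing = truncated-isCommutativeRing k }
  open PowerSeriesRing fewerVariables
  slices : IsRingMonomorphism (truncatedRawRing (suc k)) (CommutativeRing.rawRing powerSeriesRing) (flip slice)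
  slices = record
    { isRingHomomorphism = record
      { isSemiringHomomorphism = record
        { isNearSemiringHomomorphism = record
          { +-isMonoidHomomorphism = record
            { isMagmaHomomorphism = record { isRelHomomorphism = record { cong = id } ; homo = λ _ _ _ → ≈ₛ⇒≈[] k λ _ → ≡.refl }
            ; ε-homo = λ _ → ≈ₛ⇒≈[] k λ _ → ≡.refl
            }
          ; *-homo = λ f g n → ≈ₛ⇒≈[] k (slice-* n f g)
          }
        ; 1#-homo = λ { zero → ≈ₛ⇒≈[] k λ _ → ≡.refl ; (suc _) → ≈ₛ⇒≈[] k λ _ → ≡.refl }
        }
      ; -‿homo = λ _ _ → ≈ₛ⇒≈[] k λ _ → ≡.refl
      }
    ; injective = id
    }

truncated : ℕ → CommutativeRing 0ℓ 0ℓ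
truncated k = record { isCommutativeRing = truncated-isCommutativeRing k }

-- Proper colourings of paths as words with distinct neighbours.

Linked-lookup : ∀ {R : Rel ℕ 0ℓ} {n} {w : Vec ℕ n} → Linked R w → ∀ u v → toℕ v ≡ suc (toℕ u) → R (lookup w u) (lookup w v)
Linked-lookup {w = _ ∷ _ ∷ _} (r ∷ _)  zero    (suc zero) _  = r
Linked-lookup (_ ∷ rs) (suc u) (suc v)    eq = Linked-lookup rs u v (ℕ.suc-injective eq)

linked⇒proper : ∀ {n} {w : Vec ℕ n} → Linked _≢_ w → Proper (path n) w
linked⇒proper l u v (inj₁ v≡1+u) = Linked-lookup l u v v≡1+u
linked⇒proper l u v (inj₂ u≡1+v) = Linked-lookup l v u u≡1+v ∘ ≡.sym

proper⇒linked : ∀ {n} (w : Vec ℕ n) → Proper (path n) w → Linked _≢_ w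
proper⇒linked []          p = []
proper⇒linked (c ∷ [])    p = [-]
proper⇒linked (c ∷ d ∷ w) p = p zero (suc zero) (inj₁ ≡.refl) ∷
  proper⇒linked (d ∷ w) λ u v adj → p (suc u) (suc v) (Sum.map (≡.cong suc) (≡.cong suc) adj)

-- Coefficientwise identities between K, G, D and E.

z∙d/dz : (ℕ → Series) → ℕ → Series
z∙d/dz f n = n · f n

-- In degree n ≥ 2 this is n eₙ - (n - 1) eₙ = eₙ. Since `G` vanishes in degrees 0 and 1, those are
-- separate cases.
D+zE′≈E : D + z∙d/dz e ≈ e
D+zE′≈E zero          a = ℤ.+-identityʳ (coeff-1 a ℤ.+ ℤ.0ℤ)
D+zE′≈E (suc zero)    a = ≡.trans (ℤ.+-identityˡ (coeff (e 1) a ℤ.+ ℤ.0ℤ)) (ℤ.+-identityʳ (coeff (e 1) a))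
D+zE′≈E n@(suc (suc m)) a = begin
  ℤ.0ℤ ℤ.- t ℤ.+ (coeff (e n) a ℤ.+ t)      ≡⟨ ≡.cong (ℤ._+ (coeff (e n) a ℤ.+ t)) (ℤ.+-identityˡ (ℤ.- t)) ⟩
  ℤ.- t ℤ.+ (coeff (e n) a ℤ.+ t)           ≡⟨ ≡.cong (λ s → ℤ.- t ℤ.+ s) (ℤ.+-comm (coeff (e n) a) t) ⟩
  ℤ.- t ℤ.+ (t ℤ.+ coeff (e n) a)           ≡⟨ ℤ.+-assoc (ℤ.- t) t (coeff (e n) a) ⟨
  ℤ.- t ℤ.+ t ℤ.+ coeff (e n) a             ≡⟨ ≡.cong (ℤ._+ coeff (e n) a) (ℤ.+-inverseˡ t) ⟩
  ℤ.0ℤ ℤ.+ coeff (e n) a                    ≡⟨ ℤ.+-identityˡ (coeff (e n) a) ⟩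
  coeff (e n) a                             ∎
  where
  open ≡.≡-Reasoning
  t = coeff (suc m · e n) a

D+G≈1 : D + G ≈ 1#
D+G≈1 n a = ≡.trans (ℤ.+-assoc (coeff (1# n) a) (ℤ.- coeff (G n) a) (coeff (G n) a))
  (≡.trans (≡.cong (λ t → coeff (1# n) a ℤ.+ t) (ℤ.+-inverseˡ (coeff (G n) a))) (ℤ.+-identityʳ _))

-- In degree n ≥ 2 this is n eₙ = eₙ + (n - 1) eₙ, which is how `_·_` unfolds; 1 + e₁ z supplies the
-- degrees 0 and 1 that `K` and `G` lack.
K+1+e₁z≈E+G : K + (1# + e₁z) ≈ e + G
K+1+e₁z≈E+G zero          a = ≡.trans (ℤ.+-identityˡ (coeff (e 0) a)) (≡.sym (ℤ.+-identityʳ (coeff (e 0) a)))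
K+1+e₁z≈E+G (suc zero)    a = ≡.trans (ℤ.+-identityˡ _)
  (≡.trans (ℤ.+-identityˡ (coeff (e 1) a)) (≡.sym (ℤ.+-identityʳ (coeff (e 1) a))))
K+1+e₁z≈E+G (suc (suc m)) a = ℤ.+-identityʳ _

-- The identity in k variables, and its passage to all monomials.

module _ (k : ℕ) where
  private
    T = truncated k
    module T = CommutativeRing T
  open PowerSeriesRing T
  private module S = CommutativeRing powerSeriesRing
  open WordSum T x (upTo k)
  open SemiringMult T.semiring using (_×_; ×-congʳ)

  ×≡· : ∀ n f → n × f ≡ n · f
  ×≡· zero    f = ≡.refl
  ×≡· (suc n) f = ≡.cong (f +ₛ_) (×≡· n f)

  ∏≡∏x : ∀ {n} (w : Vec ℕ n) → ∏ w ≡ ∏x w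
  ∏≡∏x []      = ≡.refl
  ∏≡∏x (c ∷ w) = ≡.cong (x c *ₛ_) (∏≡∏x w)

  -- The coefficient of `∑∏x P?` at `a` is defined by the finite sum over letters below `length a`,
  -- and `_≈[_]_` only tests lists of length `k`.
  ∑∏x≈wordSum : ∀ {n} {P : Unary.Pred (Vec ℕ n) 0ℓ} (P? : Unary.Decidable P) → ∑∏x P? ≈[ k ] wordSum P?
  ∑∏x≈wordSum {n} P? = agree⇒≈[] k λ { a ≡.refl → ≡.cong (λ fs → coeff (foldr _+ₛ_ 0ₛ fs) a)
    (≡.sym (map-cong ∏≡∏x (filter P? (words n (upTo k))))) }

  e≋E : e ≋ E.linkedSum
  e≋E n = ∑∏x≈wordSum {n} (linked? ℕ._<?_)

  𝒳ₚ≋X : 𝒳ₚ ≋ X.linkedSum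
  𝒳ₚ≋X n = T.trans (∑∏x≈wordSum (proper? (path n))) (T.reflexive (≡.cong (λ ws → foldr _+ₛ_ 0ₛ (map ∏ ws))
    (filter-≐ (proper? (path n)) (linked? _) ((λ {w} → proper⇒linked w) , linked⇒proper) (words n (upTo k)))))

  -- Both are defined by cases, over raw rings with different equalities, so they are compared
  -- degree by degree.
  1#≋𝟙 : 1# ≋ 𝟙
  1#≋𝟙 zero    = T.refl {1ₛ}
  1#≋𝟙 (suc n) = T.refl {0ₛ}

  E*X≋E+zE′*X : e * 𝒳ₚ ≋ e + z∙d/dz e * 𝒳ₚ
  E*X≋E+zE′*X = begin
    e * 𝒳ₚ                           ≈⟨ S.*-cong e≋E 𝒳ₚ≋X ⟩
    E.linkedSum ⊛ X.linkedSum        ≈⟨ E⊛X≋E⊕zE′⊛X (applyUpTo⁺₁ id k λ i<j _ → i<j) ⟩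
    E.linkedSum ⊕ (λ n → n × E.linkedSum n) ⊛ X.linkedSum
      ≈⟨ S.+-cong e≋E (S.*-cong (λ n → T.trans (T.reflexive (≡.sym (×≡· n (e n)))) (×-congʳ n (e≋E n))) 𝒳ₚ≋X) ⟨
    e + z∙d/dz e * 𝒳ₚ                ∎
    where open ≈-Reasoning S.setoid

  D*/ : ∀ f → D * (f / D) ≋ f
  D*/ f n = ≈ₛ⇒≈[] k (*-/-cancel f D D-constant n)

  𝒳ₚ≋K/D+e₁z*G/D+1+e₁z : 𝒳ₚ ≋ K / D + e₁z * (G / D) + (1# + e₁z)
  -- `1# / D` is the inverse by which `D` is cancelled.
  𝒳ₚ≋K/D+e₁z*G/D+1+e₁z = Quotients.X≈U+yV+u+y powerSeriesRing {D} {e} {z∙d/dz e} {𝒳ₚ} {G} {K} {K / D} {G / D} {1# / D} {e₁z} {1#}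
    1#≋𝟙 (λ n → ≈ₛ⇒≈[] k (D+zE′≈E n)) E*X≋E+zE′*X (λ n → ≈ₛ⇒≈[] k (D+G≈1 n)) (D*/ K) (D*/ G) (D*/ 1#)
    (λ n → ≈ₛ⇒≈[] k (K+1+e₁z≈E+G n))

corollary3p4 : 𝒳ₚ ≈ K / D + e₁z * (G / D) + (1# + e₁z)
-- The monomial `a` involves only the first `length a` variables, so that many suffice for its
-- coefficient.
corollary3p4 n a = ≈[]⇒agree a (𝒳ₚ≋K/D+e₁z*G/D+1+e₁z (length a) n)
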